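{- Let $G=(V,E)$ be a finite undirected loopless graph, $k$ a positive integer, and $f,g:V\to\mathbb{Z}$ with $f\le g$. A $k$-edge-connected and in-degree constrained orientation $D$ of $G$ is decreasingly minimal (among the $k$-edge-connected in-degree constrained orientations of $G$) if and only if there are no two nodes $s$ and $t$ for which $\varrho_D(t)\ge\varrho_D(s)+2$, $\varrho_D(t)>f(t)$, $\varrho_D(s)<g(s)$, and there are $k+1$ arc-disjoint directed paths from $s$ to $t$ in $D$.
   Context: $\varrho_D(X)$ is the number of arcs of $D$ entering $X\subseteq V$. $D$ is $k$-edge-connected if $\varrho_D(X)\ge k$ for every $\emptyset\ne X\subsetneq V$; it is in-degree constrained if $f(v)\le\varrho_D(v)\le g(v)$ for every $v\in V$. An orientation is decreasingly minimal among a family of orientations if its in-degree vector, sorted in decreasing order, is lexicographically smaller than or equal to that of every member of the family sorted likewise. -}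

module Defs where

open import Data.Nat using (ℕ; zero; suc; _<_)
open import Data.Integer as ℤ using (ℤ; +_)
open import Data.Fin using (Fin; _≟_)
open import Data.Bool using (Bool; true; false; if_then_else_; _∧_; not)
open import Data.Nat.ListAction using (sum)
open import Data.List using (List; []; _∷_; map; allFin; reverse; concat)
open import Data.List.Relation.Unary.Unique.Propositional using (Unique)
open import Data.Vec as Vec using (Vec)
open import Data.Product using (_×_; Σ; ∃; ∃-syntax; _,_; proj₁; proj₂)
open import Relation.Nullary using (¬_)
open import Relation.Nullary.Decidable using (⌊_⌋)
open import Relation.Binary.PropositionalEquality using (_≡_; _≢_)
open import Data.Nat.Properties using (≤-decTotalOrder)
open import Data.List.Sort ≤-decTotalOrder using (sort)

-- A finite undirected loopless (multi)graph on vertex set Fin n with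
-- m edges; edge i joins the two ends of E i.
Edges : ℕ → ℕ → Set
Edges n m = Fin m → Fin n × Fin n

Loopless : ∀ {n m} → Edges n m → Set
Loopless E = ∀ i → proj₁ (E i) ≢ proj₂ (E i)

-- An orientation: for every edge, true = oriented from first end to
-- second end, false = oriented from second end to first end.
Orientation : ℕ → Set
Orientation m = Fin m → Bool

tl : ∀ {n m} → Edges n m → Orientation m → Fin m → Fin n
tl E D i = if D i then proj₁ (E i) else proj₂ (E i)

hd : ∀ {n m} → Edges n m → Orientation m → Fin m → Fin n
hd E D i = if D i then proj₂ (E i) else proj₁ (E i)

VSet : ℕ → Set
VSet n = Fin n → Bool

ρ : ∀ {n m} → Edges n m → Orientation m → VSet n → ℕ
ρ {m = m} E D X =
  sum (map (λ i → if X (hd E D i) ∧ not (X (tl E D i)) then 1 else 0) (allFin m))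

singleton : ∀ {n} → Fin n → VSet n
singleton v u = ⌊ u ≟ v ⌋

indeg : ∀ {n m} → Edges n m → Orientation m → Fin n → ℕ
indeg E D v = ρ E D (singleton v)

KEdgeConnected : ∀ {n m} → ℕ → Edges n m → Orientation m → Set
KEdgeConnected {n} k E D =
  (X : VSet n) → (∃[ v ] X v ≡ true) → (∃[ v ] X v ≡ false) → k Data.Nat.≤ ρ E D X

InDegConstrained : ∀ {n m} → (f g : Fin n → ℤ) → Edges n m → Orientation m → Set
InDegConstrained f g E D =
  ∀ v → (f v ℤ.≤ + indeg E D v) × (+ indeg E D v ℤ.≤ g v)

Feasible : ∀ {n m} → ℕ → (f g : Fin n → ℤ) → Edges n m → Orientation m → Set
Feasible k f g E D = KEdgeConnected k E D × InDegConstrained f g E D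

sortedInDegs : ∀ {n m} → Edges n m → Orientation m → List ℕ
sortedInDegs {n} E D = reverse (sort (map (indeg E D) (allFin n)))

data LexLeq : List ℕ → List ℕ → Set where
  [] : ∀ {ys} → LexLeq [] ys
  lt : ∀ {x y xs ys} → x < y → LexLeq (x ∷ xs) (y ∷ ys)
  eq : ∀ {x y xs ys} → x ≡ y → LexLeq xs ys → LexLeq (x ∷ xs) (y ∷ ys)

DecMin : ∀ {n m} → ℕ → (f g : Fin n → ℤ) → Edges n m → Orientation m → Set
DecMin {m = m} k f g E D =
  (D' : Orientation m) → Feasible k f g E D' → LexLeq (sortedInDegs E D) (sortedInDegs E D')

data Walk {n m} (E : Edges n m) (D : Orientation m) : Fin n → Fin n → List (Fin m) → Set where
  nil  : ∀ {v} → Walk E D v v []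
  cons : ∀ {u w a as} → tl E D a ≡ u → Walk E D (hd E D a) w as → Walk E D u w (a ∷ as)

Path : ∀ {n m} → Edges n m → Orientation m → Fin n → Fin n → List (Fin m) → Set
Path E D u w as = Walk E D u w as × Unique (u ∷ map (hd E D) as)

ArcDisjointPaths : ∀ {n m} → ℕ → Edges n m → Orientation m → Fin n → Fin n → Set
ArcDisjointPaths {m = m} j E D s t =
  Σ (Vec (List (Fin m)) j) λ ps →
    (∀ i → Path E D s t (Vec.lookup ps i)) × Unique (concat (Vec.toList ps))

{-# OPTIONS --safe #-}
module Submission where

-- Necessity: reversing one of the k + 1 paths moves one unit of in-degree from t to s and keeps
-- every cut at least k.
--
-- Sufficiency: let x and y be the in-degree vectors of D and of another feasible orientation. It
-- suffices that Σ (x ∸ j) ≤ Σ (y ∸ j) for every j, i.e. that x is majorized by y. By Menger, each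
-- t with x t > j, x t > f t is separated from each s with x s < j, x s < g s by a tight set
-- (in-degree k in D), and tight sets satisfy x(X) ≤ y(X). For fixed s, intersecting tight sets
-- avoiding s are merged, so that disjoint tight sets cover all t; taking these sets for all s
-- together, the points covered most often form a set Z that contains every t and no s. Then
-- x(Z) ≤ y(Z), because this holds for all level sets of the covering multiplicity of any list of
-- tight sets, and the bound for j follows by comparing x and y inside and outside Z.

open import Defs
open import Data.Bool using (Bool; true; false; if_then_else_; _∧_; _∨_; not)
import Data.Bool as Bool
open import Data.Bool.Properties using (not-involutive; not-injective)
open import Data.Empty using (⊥; ⊥-elim)
open import Data.Nat using (ℕ; zero; suc; _+_; _∸_; _⊔_; _≤_; _<_; _≥_; z≤n; s≤s; s≤s⁻¹; _≤?_; _<?_)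
import Data.Nat as ℕ
open import Relation.Binary.Definitions using (tri<; tri≈; tri>)
open import Data.Nat.Properties hiding (_≟_; _≤?_; _<?_)
open import Data.Nat.ListAction using (sum)
open import Data.Nat.ListAction.Properties using (sum-++; sum-↭)
open import Data.Nat.Solver using (module +-*-Solver)
open import Data.Integer as ℤ using (ℤ; +_)
import Data.Integer.Properties as ℤ
open import Data.Fin using (Fin; zero; suc; _≟_)
open import Data.Fin.Properties using (any?)
open import Data.List using (List; []; _∷_; _++_; map; allFin; reverse; concat; length; filter)
open import Data.List.Properties using (map-cong; map-++; map-∘; length-map; unfold-reverse)
open import Data.List.Membership.Propositional using (_∈_; _∉_)
open import Data.List.Membership.Propositional.Properties using (∈-allFin; ∈-filter⁺; ∈-filter⁻)
open import Data.List.Relation.Unary.Any using (Any; here; there)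
import Data.List.Relation.Unary.Any as Any
open import Data.List.Relation.Unary.All using (All; []; _∷_)
import Data.List.Relation.Unary.All as All
import Data.List.Relation.Unary.All.Properties as All
open import Data.List.Relation.Unary.AllPairs using (AllPairs; []; _∷_)
import Data.List.Relation.Unary.AllPairs.Properties as AllPairs
open import Data.List.Relation.Unary.Unique.Propositional using (Unique)
import Data.List.Relation.Unary.Unique.Propositional.Properties as Unique
open import Data.List.Relation.Unary.Sorted.TotalOrder.Properties using (Sorted⇒AllPairs)
open import Data.List.Relation.Binary.Permutation.Propositional using (_↭_; ↭-refl; ↭-sym; ↭-trans; prep; swap)
open import Data.List.Relation.Binary.Permutation.Propositional.Properties using (↭-reverse; ↭-length; All-resp-↭; map⁺)
open import Data.List.Sort ≤-decTotalOrder using (sort-↭; sort-↗)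
open import Data.Vec as Vec using (Vec; []; _∷_)
open import Data.Product using (_×_; Σ; ∃-syntax; _,_; proj₁; proj₂)
open import Data.Sum using (_⊎_; inj₁; inj₂)
open import Function.Base using (_∘_)
open import Function.Bundles using (_⇔_; mk⇔)
open import Relation.Nullary using (¬_; Dec; yes; no; contradiction)
open import Relation.Nullary.Decidable using (⌊_⌋; _×-dec_)
open import Relation.Binary.PropositionalEquality using (_≡_; _≢_; refl; sym; trans; cong; cong₂; subst; subst₂; module ≡-Reasoning)

-- Finite sums

∑ : {A : Set} → List A → (A → ℕ) → ℕ
∑ xs f = sum (map f xs)

module _ {A : Set} where

  ∑-cong : ∀ {f g : A → ℕ} xs → (∀ x → f x ≡ g x) → ∑ xs f ≡ ∑ xs g
  ∑-cong xs f≗g = cong sum (map-cong f≗g xs)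

  ∑-mono : ∀ {f g : A → ℕ} xs → (∀ x → f x ≤ g x) → ∑ xs f ≤ ∑ xs g
  ∑-mono []       f≤g = z≤n
  ∑-mono (x ∷ xs) f≤g = +-mono-≤ (f≤g x) (∑-mono xs f≤g)

  ∑-mono-< : ∀ {f g : A → ℕ} {xs a} → a ∈ xs → f a < g a → (∀ x → f x ≤ g x) →
    ∑ xs f < ∑ xs g
  ∑-mono-< {xs = _ ∷ xs} (here refl) fa<ga f≤g = +-mono-<-≤ fa<ga (∑-mono xs f≤g)
  ∑-mono-< {xs = x ∷ _} (there a∈xs) fa<ga f≤g = +-mono-≤-< (f≤g x) (∑-mono-< a∈xs fa<ga f≤g)

  ∑-zero : ∀ (xs : List A) → ∑ xs (λ _ → 0) ≡ 0
  ∑-zero []       = refl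
  ∑-zero (_ ∷ xs) = ∑-zero xs

  ∑-+ : ∀ (f g : A → ℕ) xs → ∑ xs (λ x → f x + g x) ≡ ∑ xs f + ∑ xs g
  ∑-+ f g []       = refl
  ∑-+ f g (x ∷ xs) = trans (cong (_+_ (f x + g x)) (∑-+ f g xs))
    (solve 4 (λ a b c d → a :+ b :+ (c :+ d) := a :+ c :+ (b :+ d)) refl (f x) (g x) (∑ xs f) (∑ xs g))
    where open +-*-Solver

  -- Identities between differences of sums are stated with the negative terms moved across, since
  -- subtraction on ℕ truncates; `∑-mono-+` does the same for inequalities.
  ∑-cong-+ : ∀ {f g h l : A → ℕ} xs → (∀ x → f x + g x ≡ h x + l x) →
    ∑ xs f + ∑ xs g ≡ ∑ xs h + ∑ xs l
  ∑-cong-+ {f} {g} {h} {l} xs f+g≗h+l = begin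
    ∑ xs f + ∑ xs g          ≡⟨ ∑-+ f g xs ⟨
    ∑ xs (λ x → f x + g x)   ≡⟨ ∑-cong xs f+g≗h+l ⟩
    ∑ xs (λ x → h x + l x)   ≡⟨ ∑-+ h l xs ⟩
    ∑ xs h + ∑ xs l          ∎
    where open ≡-Reasoning

  ∑-mono-+ : ∀ {f g h l : A → ℕ} xs → (∀ x → f x + g x ≤ h x + l x) →
    ∑ xs f + ∑ xs g ≤ ∑ xs h + ∑ xs l
  ∑-mono-+ {f} {g} {h} {l} xs le = begin
    ∑ xs f + ∑ xs g          ≡⟨ ∑-+ f g xs ⟨
    ∑ xs (λ x → f x + g x)   ≤⟨ ∑-mono xs le ⟩
    ∑ xs (λ x → h x + l x)   ≡⟨ ∑-+ h l xs ⟩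
    ∑ xs h + ∑ xs l          ∎
    where open ≤-Reasoning

  ∑-++ : ∀ (f : A → ℕ) xs ys → ∑ (xs ++ ys) f ≡ ∑ xs f + ∑ ys f
  ∑-++ f xs ys = trans (cong sum (map-++ f xs ys)) (sum-++ (map f xs) (map f ys))

  ∑-↭ : ∀ (f : A → ℕ) {xs ys} → xs ↭ ys → ∑ xs f ≡ ∑ ys f
  ∑-↭ f xs↭ys = sum-↭ (map⁺ f xs↭ys)

module _ {A B : Set} where

  ∑-swap : ∀ (f : A → B → ℕ) xs ys →
    ∑ xs (λ x → ∑ ys (f x)) ≡ ∑ ys (λ y → ∑ xs (λ x → f x y))
  ∑-swap f []       ys = sym (∑-zero ys)
  ∑-swap f (x ∷ xs) ys = trans (cong (_+_ (∑ ys (f x))) (∑-swap f xs ys))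
    (sym (∑-+ (f x) (λ y → ∑ xs (λ x → f x y)) ys))

χ : Bool → ℕ
χ b = if b then 1 else 0

χ≤1 : ∀ b → χ b ≤ 1
χ≤1 true  = ≤-refl
χ≤1 false = z≤n

⌊≟⌋-refl : ∀ {n} (v : Fin n) → ⌊ v ≟ v ⌋ ≡ true
⌊≟⌋-refl v with v ≟ v
... | yes _  = refl
... | no v≢v = contradiction refl v≢v

⌊≟⌋-≢ : ∀ {n} {u v : Fin n} → u ≢ v → ⌊ u ≟ v ⌋ ≡ false
⌊≟⌋-≢ {u = u} {v} u≢v with u ≟ v
... | yes u≡v = contradiction u≡v u≢v
... | no _    = refl

module _ {m : ℕ} where

  open import Data.List.Membership.DecPropositional (_≟_ {m}) public using (_∈?_)

  private
    ∑-indicator-∉ : ∀ (φ : Fin m → ℕ) {a} xs → a ∉ xs →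
      ∑ xs (λ i → if ⌊ i ≟ a ⌋ then φ i else 0) ≡ 0
    ∑-indicator-∉ φ []       a∉xs = refl
    ∑-indicator-∉ φ {a} (x ∷ xs) a∉xs with x ≟ a
    ... | yes refl = contradiction (here refl) a∉xs
    ... | no _     = ∑-indicator-∉ φ xs (a∉xs ∘ there)

    ∑-indicator-∈ : ∀ (φ : Fin m → ℕ) {a xs} → Unique xs → a ∈ xs →
      ∑ xs (λ i → if ⌊ i ≟ a ⌋ then φ i else 0) ≡ φ a
    ∑-indicator-∈ φ {a} {_ ∷ xs} x∷xs! (here refl) rewrite ⌊≟⌋-refl a =
      trans (cong (_+_ (φ a)) (∑-indicator-∉ φ xs (Unique.Unique[x∷xs]⇒x∉xs x∷xs!))) (+-identityʳ (φ a))
    ∑-indicator-∈ φ {a} (x≢ ∷ xs!) (there a∈xs) rewrite ⌊≟⌋-≢ (All.lookup x≢ a∈xs) =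
      ∑-indicator-∈ φ xs! a∈xs

  ∑-indicator : ∀ (φ : Fin m → ℕ) a → ∑ (allFin m) (λ i → if ⌊ i ≟ a ⌋ then φ i else 0) ≡ φ a
  ∑-indicator φ a = ∑-indicator-∈ φ (Unique.allFin⁺ m) (∈-allFin a)

  -- Turns a sum along a path into a sum over all arcs, where it can be compared with `ρ` arc by
  -- arc.
  ∑-members : ∀ (φ : Fin m → ℕ) {as} → Unique as →
    ∑ (allFin m) (λ i → if ⌊ i ∈? as ⌋ then φ i else 0) ≡ ∑ as φ
  ∑-members φ []                           = ∑-zero (allFin m)
  ∑-members φ {a ∷ as} a∷as!@(_ ∷ as!) = begin
    ∑ (allFin m) (λ i → if ⌊ i ∈? (a ∷ as) ⌋ then φ i else 0)
      ≡⟨ ∑-cong (allFin m) split ⟩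
    ∑ (allFin m) (λ i → (if ⌊ i ≟ a ⌋ then φ i else 0) + (if ⌊ i ∈? as ⌋ then φ i else 0))
      ≡⟨ ∑-+ (λ i → if ⌊ i ≟ a ⌋ then φ i else 0) _ (allFin m) ⟩
    ∑ (allFin m) (λ i → if ⌊ i ≟ a ⌋ then φ i else 0) + ∑ (allFin m) (λ i → if ⌊ i ∈? as ⌋ then φ i else 0)
      ≡⟨ cong₂ _+_ (∑-indicator φ a) (∑-members φ as!) ⟩
    φ a + ∑ as φ ∎
    where
    open ≡-Reasoning
    split : ∀ i → (if ⌊ i ∈? (a ∷ as) ⌋ then φ i else 0)
                ≡ (if ⌊ i ≟ a ⌋ then φ i else 0) + (if ⌊ i ∈? as ⌋ then φ i else 0)
    split i with i ∈? (a ∷ as) | i ≟ a | i ∈? as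
    ... | _            | yes refl | yes i∈as = contradiction i∈as (Unique.Unique[x∷xs]⇒x∉xs a∷as!)
    ... | yes _        | yes _    | no _     = sym (+-identityʳ (φ i))
    ... | yes _        | no _     | yes _    = refl
    ... | yes (here p) | no i≢a   | no _     = contradiction p i≢a
    ... | yes (there p) | no _    | no i∉as  = contradiction p i∉as
    ... | no ¬p        | yes p    | no _     = contradiction (here p) ¬p
    ... | no ¬p        | no _     | yes p    = contradiction (there p) ¬p
    ... | no _         | no _     | no _     = refl

  ∑-Unique-≤ : ∀ (φ : Fin m → ℕ) {as} → Unique as → ∑ as φ ≤ ∑ (allFin m) φ
  ∑-Unique-≤ φ {as} as! = subst (_≤ ∑ (allFin m) φ) (∑-members φ as!) (∑-mono (allFin m) drop)
    where
    drop : ∀ i → (if ⌊ i ∈? as ⌋ then φ i else 0) ≤ φ i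
    drop i with i ∈? as
    ... | yes _ = ≤-refl
    ... | no _  = z≤n

-- Majorization and the lexicographic order

excess : ℕ → List ℕ → ℕ
excess j xs = ∑ xs (_∸ j)

excess-≡0 : ∀ {j xs} → All (_≤ j) xs → excess j xs ≡ 0
excess-≡0 []           = refl
excess-≡0 (x≤j ∷ xs≤j) = cong₂ _+_ (m≤n⇒m∸n≡0 x≤j) (excess-≡0 xs≤j)

-- At the first disagreement take `j` equal to the entry `y`. It is the largest remaining entry of
-- `ys`, so the right excess vanishes, and x > y would make the left one positive. Equal heads
-- cancel.
excess≤⇒LexLeq : ∀ xs ys → length xs ≡ length ys → AllPairs _≥_ ys →
  (∀ j → excess j xs ≤ excess j ys) → LexLeq xs ys
excess≤⇒LexLeq []       _        _   _            _  = []
excess≤⇒LexLeq (x ∷ xs) (y ∷ ys) len (y≥ys ∷ ys↘) le with <-cmp x y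
... | tri< x<y _ _    = lt x<y
... | tri≈ _ refl _   = eq refl (excess≤⇒LexLeq xs ys (suc-injective len) ys↘
                          λ j → +-cancelˡ-≤ (x ∸ j) _ _ (le j))
... | tri> _ _ y<x    = contradiction (<-≤-trans (m<n⇒0<n∸m y<x) (≤-trans (m≤m+n _ _) (le y)))
                          (<-irrefl (sym (excess-≡0 (≤-refl ∷ y≥ys))))

-- Used for necessity: if `ys` is majorized by `xs` and yet not lexicographically smaller, the first
-- disagreement is impossible by the argument above with the roles exchanged, so no excess can drop.
LexLeq⇒excess≤ : ∀ {xs ys} → LexLeq xs ys → AllPairs _≥_ xs →
  (∀ j → excess j ys ≤ excess j xs) → ∀ j → excess j xs ≤ excess j ys
LexLeq⇒excess≤ []               _            ge j = z≤n
LexLeq⇒excess≤ (lt {x} x<y)     (x≥xs ∷ _)   ge j =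
  contradiction (<-≤-trans (m<n⇒0<n∸m x<y) (≤-trans (m≤m+n _ _) (ge x)))
    (<-irrefl (sym (excess-≡0 (≤-refl ∷ x≥xs))))
LexLeq⇒excess≤ (eq {x} refl le) (_ ∷ xs↘)    ge j =
  +-monoʳ-≤ (x ∸ j) (LexLeq⇒excess≤ le xs↘ (λ i → +-cancelˡ-≤ (x ∸ i) _ _ (ge i)) j)

reverse-descending : ∀ {xs} → AllPairs _≤_ xs → AllPairs _≥_ (reverse xs)
reverse-descending []                           = []
reverse-descending {x ∷ xs} (x≤xs ∷ xs↗) rewrite unfold-reverse x xs =
  AllPairs.++⁺ (reverse-descending xs↗) ([] ∷ [])
    (All.map (_∷ []) (All-resp-↭ (↭-sym (↭-reverse xs)) x≤xs))

module _ {n m : ℕ} (E : Edges n m) (D : Orientation m) where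

  sortedInDegs-↭ : sortedInDegs E D ↭ map (indeg E D) (allFin n)
  sortedInDegs-↭ = ↭-trans (↭-reverse _) (sort-↭ _)

  sortedInDegs-descending : AllPairs _≥_ (sortedInDegs E D)
  sortedInDegs-descending = reverse-descending (Sorted⇒AllPairs ≤-totalOrder (sort-↗ _))

  sortedInDegs-length : length (sortedInDegs E D) ≡ length (allFin n)
  sortedInDegs-length = trans (↭-length sortedInDegs-↭) (length-map (indeg E D) (allFin n))

  sortedInDegs-excess : ∀ j → excess j (sortedInDegs E D) ≡ ∑ (allFin n) (λ v → indeg E D v ∸ j)
  sortedInDegs-excess j = trans (∑-↭ (_∸ j) sortedInDegs-↭) (sym (cong sum (map-∘ (allFin n))))

∨-introʳ : ∀ b {c} → c ≡ true → b ∨ c ≡ true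
∨-introʳ true  _ = refl
∨-introʳ false p = p

∨-introˡ : ∀ {b} c → b ≡ true → b ∨ c ≡ true
∨-introˡ _ refl = refl

χ-true : ∀ {b} → b ≡ true → χ b ≡ 1
χ-true refl = refl

χ-false : ∀ {b} → b ≡ false → χ b ≡ 0
χ-false refl = refl

χ≡0⇒false : ∀ {b} → χ b ≡ 0 → b ≡ false
χ≡0⇒false {false} _ = refl

true≢false : ∀ {b} → b ≡ true → b ≡ false → ⊥
true≢false refl ()

-- Path reversal and Menger's theorem

module _ {n m : ℕ} (E : Edges n m) where

  enters : Orientation m → VSet n → Fin m → Bool
  enters D X i = X (hd E D i) ∧ not (X (tl E D i))

  -- Telescoping: the heads along a walk are its tails shifted by one place.
  ∑-walk : ∀ {D u w as} (X : VSet n) → Walk E D u w as →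
    ∑ as (λ i → χ (X (hd E D i))) + χ (X u) ≡ ∑ as (λ i → χ (X (tl E D i))) + χ (X w)
  ∑-walk X nil = refl
  ∑-walk {D} {w = w} X (cons {a = a} {as} refl walk) = begin
    h + H + t            ≡⟨ solve 3 (λ h H t → h :+ H :+ t := t :+ (H :+ h)) refl h H t ⟩
    t + (H + h)          ≡⟨ cong (_+_ t) (∑-walk X walk) ⟩
    t + (T + χ (X w))    ≡⟨ +-assoc t T (χ (X w)) ⟨
    t + T + χ (X w)      ∎
    where
    open ≡-Reasoning
    open +-*-Solver
    h = χ (X (hd E D a))
    t = χ (X (tl E D a))
    H = ∑ as (λ i → χ (X (hd E D i)))
    T = ∑ as (λ i → χ (X (tl E D i)))

  private
    reversed-arc : ∀ (X : VSet n) (p q : Fin n) b {b₁ b₂} → b₁ ≡ b → b₂ ≡ not b →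
      χ (X (if b₂ then q else p) ∧ not (X (if b₂ then p else q))) + χ (X (if b then q else p)) ≡
      χ (X (if b₁ then q else p) ∧ not (X (if b₁ then p else q))) + χ (X (if b then p else q))
    reversed-arc X p q true refl refl with X p | X q
    ... | true  | true  = refl
    ... | true  | false = refl
    ... | false | true  = refl
    ... | false | false = refl
    reversed-arc X p q false refl refl with X p | X q
    ... | true  | true  = refl
    ... | true  | false = refl
    ... | false | true  = refl
    ... | false | false = refl

    same-arc : ∀ (X : VSet n) (p q : Fin n) {b₁ b₂} → b₁ ≡ b₂ →
      χ (X (if b₂ then q else p) ∧ not (X (if b₂ then p else q))) + 0 ≡
      χ (X (if b₁ then q else p) ∧ not (X (if b₁ then p else q))) + 0
    same-arc X p q refl = refl

  -- Reversing an arc changes its contribution by the indicator of its tail minus that of its head,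
  -- and this telescopes along the walk. Two further orientations appear because `D` need only
  -- prescribe the directions on the walk: `ρ-flip` takes D₁ = `D`, whereas in `remove-path` neither
  -- of them is `D`.
  ρ-reverse : ∀ {D u w as} → Walk E D u w as → Unique as → ∀ D₁ D₂ →
    (∀ {i} → i ∈ as → D₁ i ≡ D i × D₂ i ≡ not (D i)) → (∀ {i} → i ∉ as → D₁ i ≡ D₂ i) →
    ∀ X → ρ E D₂ X + χ (X w) ≡ ρ E D₁ X + χ (X u)
  ρ-reverse {D} {u} {w} {as} walk as! D₁ D₂ on off X = +-cancelʳ-≡ T _ _ (begin
    ρ E D₂ X + χ (X w) + T     ≡⟨ solve 3 (λ a b c → a :+ b :+ c := a :+ (c :+ b)) refl (ρ E D₂ X) (χ (X w)) T ⟩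
    ρ E D₂ X + (T + χ (X w))   ≡⟨ cong (_+_ (ρ E D₂ X)) (∑-walk X walk) ⟨
    ρ E D₂ X + (H + χ (X u))   ≡⟨ +-assoc (ρ E D₂ X) H (χ (X u)) ⟨
    ρ E D₂ X + H + χ (X u)     ≡⟨ cong (_+ χ (X u)) arcs ⟩
    ρ E D₁ X + T + χ (X u)     ≡⟨ solve 3 (λ a b c → a :+ b :+ c := a :+ c :+ b) refl (ρ E D₁ X) T (χ (X u)) ⟩
    ρ E D₁ X + χ (X u) + T     ∎)
    where
    open ≡-Reasoning
    open +-*-Solver
    H = ∑ as (λ i → χ (X (hd E D i)))
    T = ∑ as (λ i → χ (X (tl E D i)))
    pointwise : ∀ i → χ (enters D₂ X i) + (if ⌊ i ∈? as ⌋ then χ (X (hd E D i)) else 0)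
                    ≡ χ (enters D₁ X i) + (if ⌊ i ∈? as ⌋ then χ (X (tl E D i)) else 0)
    pointwise i with i ∈? as
    ... | yes i∈as = reversed-arc X (proj₁ (E i)) (proj₂ (E i)) (D i) (proj₁ (on i∈as)) (proj₂ (on i∈as))
    ... | no i∉as  = same-arc X (proj₁ (E i)) (proj₂ (E i)) (off i∉as)
    arcs : ρ E D₂ X + H ≡ ρ E D₁ X + T
    arcs = begin
      ρ E D₂ X + H ≡⟨ cong (_+_ (ρ E D₂ X)) (∑-members (λ i → χ (X (hd E D i))) as!) ⟨
      ρ E D₂ X + _ ≡⟨ ∑-cong-+ (allFin m) pointwise ⟩
      ρ E D₁ X + _ ≡⟨ cong (_+_ (ρ E D₁ X)) (∑-members (λ i → χ (X (tl E D i))) as!) ⟩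
      ρ E D₁ X + T ∎

  Path⇒Unique-arcs : ∀ {D u w as} → Path E D u w as → Unique as
  Path⇒Unique-arcs (_ , _ ∷ heads!) = Unique.map⁻ heads!

  flip : List (Fin m) → Orientation m → Orientation m
  flip as D i = if ⌊ i ∈? as ⌋ then not (D i) else D i

  flip-∈ : ∀ {as} D {i} → i ∈ as → flip as D i ≡ not (D i)
  flip-∈ {as} D {i} i∈as with i ∈? as
  ... | yes _   = refl
  ... | no i∉as = contradiction i∈as i∉as

  flip-∉ : ∀ {as} D {i} → i ∉ as → flip as D i ≡ D i
  flip-∉ {as} D {i} i∉as with i ∈? as
  ... | yes i∈as = contradiction i∈as i∉as
  ... | no _     = refl

  ρ-flip : ∀ {D u w as} → Path E D u w as → ∀ X → ρ E (flip as D) X + χ (X w) ≡ ρ E D X + χ (X u)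
  ρ-flip {D} path@(walk , _) = ρ-reverse walk (Path⇒Unique-arcs path) D _
    (λ i∈as → refl , flip-∈ D i∈as) (λ i∉as → sym (flip-∉ D i∉as))

  module Reachability (D : Orientation m) (ok : Fin m → Bool) (t : Fin n) where

    Closed : VSet n → Set
    Closed R = ∀ a → ok a ≡ true → R (hd E D a) ≡ true → R (tl E D a) ≡ true

    -- The last component keeps the path inside `R`, so that a new vertex outside `R` can be put in
    -- front without repeating a vertex.
    Linked : VSet n → Fin n → Set
    Linked R v = ∃[ as ] Path E D v t as × All (λ a → ok a ≡ true) as
                         × All (λ w → R w ≡ true) (v ∷ map (hd E D) as)

    missing : VSet n → ℕ
    missing R = ∑ (allFin n) (λ v → χ (not (R v)))

    -- Backward search: while some allowed arc enters `R`, its tail is added. The fuel bounds the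
    -- number of vertices still missing.
    grow : ∀ fuel R → missing R < fuel → R t ≡ true → (∀ v → R v ≡ true → Linked R v) →
      ∃[ R′ ] R′ t ≡ true × (∀ v → R′ v ≡ true → Linked R′ v) × Closed R′
    grow (suc fuel) R (s≤s missing≤) t∈R linked
      with any? (λ a → (ok a Bool.≟ true) ×-dec (R (hd E D a) Bool.≟ true) ×-dec (R (tl E D a) Bool.≟ false))
    ... | no ¬leaving = R , t∈R , linked , closed
      where
      closed : Closed R
      closed a ok-a h∈R with R (tl E D a) in t∉R
      ... | true  = refl
      ... | false = contradiction (a , ok-a , h∈R , t∉R) ¬leaving
    ... | yes (a , ok-a , h∈R , z∉R) = grow fuel R′ (<-≤-trans smaller missing≤) (⊆R′ t∈R) linked′
      where
      z = tl E D a
      R′ : VSet n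
      R′ v = R v ∨ ⌊ v ≟ z ⌋
      ⊆R′ : ∀ {v} → R v ≡ true → R′ v ≡ true
      ⊆R′ = ∨-introˡ _
      z∈R′ : R′ z ≡ true
      z∈R′ = ∨-introʳ (R z) (⌊≟⌋-refl z)
      smaller : missing R′ < missing R
      smaller = ∑-mono-< (∈-allFin z) strict weak
        where
        strict : χ (not (R′ z)) < χ (not (R z))
        strict rewrite z∈R′ | z∉R = ≤-refl
        weak : ∀ v → χ (not (R′ v)) ≤ χ (not (R v))
        weak v with R v
        ... | true  = z≤n
        ... | false = χ≤1 _
      linked′ : ∀ v → R′ v ≡ true → Linked R′ v
      linked′ v v∈R′ with R v in v∈R
      ... | true with as , path , oks , inR ← linked v v∈R = as , path , oks , All.map ⊆R′ inR
      linked′ v v∈R′ | false with v ≟ z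
      ... | yes refl with as , (walk , vs!) , oks , inR ← linked (hd E D a) h∈R =
        a ∷ as
        , (cons refl walk , All.map (λ { w∈R refl → true≢false w∈R z∉R }) inR ∷ vs!)
        , ok-a ∷ oks
        , z∈R′ ∷ All.map ⊆R′ inR
      linked′ v () | false | no _

    search : ∀ s → (∃[ as ] Path E D s t as × All (λ a → ok a ≡ true) as)
                 ⊎ (∃[ X ] X t ≡ true × X s ≡ false × Closed X)
    search s with grow _ (singleton t) ≤-refl (⌊≟⌋-refl t) start
      where
      start : ∀ v → singleton t v ≡ true → Linked (singleton t) v
      start v v∈ with v ≟ t
      ... | yes refl = [] , (nil , [] ∷ []) , [] , ⌊≟⌋-refl t ∷ []
    ... | R , t∈R , linked , closed with R s in s∈R
    ...   | true with as , path , oks , _ ← linked s s∈R = inj₁ (as , path , oks)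
    ...   | false = inj₂ (R , t∈R , s∈R , closed)

  open Reachability using (search)

  -- Encodes a flow of value j from s to t: the arcs on which D* differs from D.
  Flow : ℕ → Orientation m → Orientation m → Fin n → Fin n → Set
  Flow j D D* s t = ∀ X → X t ≡ true → X s ≡ false → ρ E D X ≡ j + ρ E D* X

  -- D* is its own residual graph: reversing a path of D* augments the flow.
  augment : ∀ j D s t →
    (∃[ D* ] Flow j D D* s t) ⊎ (∃[ X ] X t ≡ true × X s ≡ false × ρ E D X < j)
  augment zero    D s t = inj₁ (D , λ _ _ _ → refl)
  augment (suc j) D s t with augment j D s t
  ... | inj₂ (X , t∈X , s∉X , small) = inj₂ (X , t∈X , s∉X , m<n⇒m<1+n small)
  ... | inj₁ (D* , flow) with search D* (λ _ → true) t s
  ...   | inj₂ (X , t∈X , s∉X , closed) = inj₂ (X , t∈X , s∉X , ≤-reflexive (cong suc cut))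
    where
    no-entry : ∀ i → χ (enters D* X i) ≡ 0
    no-entry i with X (hd E D* i) in h∈X
    ... | false = refl
    ... | true rewrite closed i refl h∈X = refl
    cut : ρ E D X ≡ j
    cut = trans (flow X t∈X s∉X)
      (trans (cong (_+_ j) (trans (∑-cong (allFin m) no-entry) (∑-zero (allFin m)))) (+-identityʳ j))
  ...   | inj₁ (as , path , _) = inj₁ (flip as D* , λ X t∈X s∉X →
            trans (flow X t∈X s∉X) (trans (cong (_+_ j) (step X t∈X s∉X)) (+-suc j _)))
    where
    step : ∀ X → X t ≡ true → X s ≡ false → ρ E D* X ≡ suc (ρ E (flip as D*) X)
    step X t∈X s∉X with p ← ρ-flip path X rewrite t∈X | s∉X =
      trans (sym (+-identityʳ _)) (trans (sym p) (+-comm _ 1))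

  differ : Orientation m → Orientation m → Fin m → Bool
  differ D D* i = ⌊ D* i Bool.≟ not (D i) ⌋

  differ⇒ : ∀ D D* {i} → differ D D* i ≡ true → D* i ≡ not (D i)
  differ⇒ D D* {i} p with D* i Bool.≟ not (D i)
  ... | yes q = q

  ¬differ⇒ : ∀ D D* {i} → differ D D* i ≡ false → D* i ≡ D i
  ¬differ⇒ D D* {i} p with D* i | D i
  ... | true  | true  = refl
  ... | false | false = refl
  ¬differ⇒ D D* {i} () | true | false
  ¬differ⇒ D D* {i} () | false | true

  flip-differ : ∀ {D D* as i} → differ D D* i ≡ true → i ∈ as → flip as D* i ≡ D i
  flip-differ {D} {D*} {i = i} d i∈as =
    trans (flip-∈ D* i∈as) (trans (cong not (differ⇒ D D* d)) (not-involutive (D i)))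

  -- On the path `D*` is opposite to `D`, so flipping it restores the directions of `D` there and
  -- returns one unit to every cut that contains `t` but not `s`.
  remove-path : ∀ {j D D* s t as} → Flow (suc j) D D* s t → Path E D s t as →
    All (λ a → differ D D* a ≡ true) as → Flow j D (flip as D*) s t
  remove-path {j} {D} {D*} {as = as} flow path@(walk , _) diffs X t∈X s∉X
    with p ← ρ-reverse walk (Path⇒Unique-arcs path) (flip as D*) D*
               (λ i∈as → flip-differ {D} {D*} (All.lookup diffs i∈as) i∈as , differ⇒ D D* (All.lookup diffs i∈as)) (flip-∉ D*) X
       | q ← flow X t∈X s∉X
    rewrite t∈X | s∉X = trans q (trans (sym (+-suc j _))
      (cong (_+_ j) (trans (+-comm 1 _) (trans p (+-identityʳ _)))))

  -- The paths use only arcs on which `D*` differs from `D`. This invariant gives disjointness: once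
  -- the first path is removed, its arcs agree with `D` and cannot be used again.
  decompose : ∀ j D D* s t → Flow j D D* s t →
    Σ (Vec (List (Fin m)) j) λ ps → (∀ i → Path E D s t (Vec.lookup ps i))
      × Unique (concat (Vec.toList ps)) × All (λ a → differ D D* a ≡ true) (concat (Vec.toList ps))
  decompose zero    D D* s t flow = [] , (λ ()) , [] , []
  decompose (suc j) D D* s t flow with search D (differ D D*) t s
  -- No differing arc of `D` enters `X`, so every arc entering `X` in `D` still enters it in `D*`.
  -- Hence the cut did not decrease, against a positive flow value.
  ... | inj₂ (X , t∈X , s∉X , closed) = contradiction (flow X t∈X s∉X) (<⇒≢ (s≤s (≤-trans le (m≤n+m _ j))))
    where
    entry-≤ : ∀ i → χ (enters D X i) ≤ χ (enters D* X i)
    entry-≤ i with differ D D* i in diff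
    ... | false = ≤-reflexive (cong (λ b → χ (X (if b then proj₂ (E i) else proj₁ (E i))
                     ∧ not (X (if b then proj₁ (E i) else proj₂ (E i))))) (sym (¬differ⇒ D D* diff)))
    ... | true with X (hd E D i) in h∈X
    ...   | false = z≤n
    ...   | true rewrite closed i diff h∈X = z≤n
    le : ρ E D X ≤ ρ E D* X
    le = ∑-mono (allFin m) entry-≤
  ... | inj₁ (as , path@(walk , _) , diffs)
    with ps , paths , ps! , ps-diff ← decompose j D (flip as D*) s t (remove-path flow path diffs) =
      as ∷ ps , (λ { zero → path ; (suc i) → paths i })
      , Unique.++⁺ (Path⇒Unique-arcs path) ps!
          (λ { (i∈as , i∈ps) → fresh i∈as (All.lookup ps-diff i∈ps) })
      , All.++⁺ diffs (All.tabulate keep)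
    where
    fresh : ∀ {i} → i ∈ as → differ D (flip as D*) i ≡ true → ⊥
    fresh {i} i∈as d with q ← trans (sym (flip-∈ D* i∈as)) (differ⇒ D (flip as D*) d)
      rewrite differ⇒ D D* (All.lookup diffs i∈as) with D i | q
    ... | true  | ()
    ... | false | ()
    keep : ∀ {i} → i ∈ concat (Vec.toList ps) → differ D D* i ≡ true
    keep {i} i∈ps with All.lookup ps-diff i∈ps
    ... | d with i ∈? as
    ...   | yes i∈as = All.lookup diffs i∈as
    ...   | no _     = d

  menger : ∀ k D s t →
    ArcDisjointPaths (suc k) E D s t ⊎ (∃[ X ] X t ≡ true × X s ≡ false × ρ E D X ≤ k)
  menger k D s t with augment (suc k) D s t
  ... | inj₂ (X , t∈X , s∉X , s≤s small) = inj₂ (X , t∈X , s∉X , small)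
  ... | inj₁ (D* , flow) with ps , paths , ps! , _ ← decompose (suc k) D D* s t flow =
    inj₁ (ps , paths , ps!)

  walk-enters : ∀ {D u w as} (X : VSet n) → Walk E D u w as → X w ≡ true → X u ≡ false →
    1 ≤ ∑ as (λ i → χ (enters D X i))
  walk-enters X nil w∈X u∉X = ⊥-elim (true≢false w∈X u∉X)
  walk-enters {D} X (cons {a = a} refl walk) w∈X u∉X with X (hd E D a) in h∈X
  ... | true rewrite u∉X = s≤s z≤n
  ... | false = walk-enters X walk w∈X h∈X

  -- Each path enters `X` at least once, and disjointness prevents an arc from being counted twice.
  paths-enter : ∀ {j D s t} → ArcDisjointPaths j E D s t → ∀ X → X t ≡ true → X s ≡ false →
    j ≤ ρ E D X
  paths-enter {D = D} {s} {t} (ps , paths , ps!) X t∈X s∉X =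
    ≤-trans (count ps paths) (∑-Unique-≤ (λ i → χ (enters D X i)) ps!)
    where
    count : ∀ {j} (ps : Vec _ j) → (∀ i → Path E D s t (Vec.lookup ps i)) →
      j ≤ ∑ (concat (Vec.toList ps)) (λ i → χ (enters D X i))
    count []       paths = z≤n
    count (p ∷ ps) paths = ≤-trans
      (+-mono-≤ (walk-enters X (proj₁ (paths zero)) t∈X s∉X) (count ps (paths ∘ suc)))
      (≤-reflexive (sym (∑-++ _ p (concat (Vec.toList ps)))))

-- Level sets of crossing families

_∩_ _∪_ : ∀ {n} → VSet n → VSet n → VSet n
(X ∩ Y) v = X v ∧ Y v
(X ∪ Y) v = X v ∨ Y v

∁ : ∀ {n} → VSet n → VSet n
∁ X v = not (X v)

mass : ∀ {n} → (Fin n → ℕ) → VSet n → ℕ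
mass {n} x X = ∑ (allFin n) (λ v → if X v then x v else 0)

mass-cong : ∀ {n} {x : Fin n → ℕ} {X Y : VSet n} → (∀ v → X v ≡ Y v) → mass x X ≡ mass x Y
mass-cong {n} {x} X≗Y = ∑-cong (allFin n) (λ v → cong (λ b → if b then x v else 0) (X≗Y v))

-- The equation of indicators encodes a disjoint union: a point in both sets would give 2 on the
-- left.
mass-⊎ : ∀ {n} {x : Fin n → ℕ} {X Y Z : VSet n} → (∀ v → χ (X v) + χ (Y v) ≡ χ (Z v)) →
  mass x X + mass x Y ≡ mass x Z
mass-⊎ {n} {x} {X} {Y} {Z} X⊎Y≗Z =
  trans (sym (∑-+ (λ v → if X v then x v else 0) _ (allFin n))) (∑-cong (allFin n) pointwise)
  where
  pointwise : ∀ v → (if X v then x v else 0) + (if Y v then x v else 0) ≡ (if Z v then x v else 0)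
  pointwise v with X v | Y v | Z v | X⊎Y≗Z v
  ... | true  | false | true  | _ = +-identityʳ (x v)
  ... | false | true  | true  | _ = refl
  ... | false | false | false | _ = refl

χ-∩∪ : ∀ b c → χ (b ∧ c) + χ (b ∨ c) ≡ χ b + χ c
χ-∩∪ true  c = +-comm (χ c) 1
χ-∩∪ false c = refl

χ-∁ : ∀ b → χ b + χ (not b) ≡ χ true
χ-∁ true  = refl
χ-∁ false = refl

size : ∀ {n} → VSet n → ℕ
size {n} X = ∑ (allFin n) (λ v → χ (X v))

⊂⇒size< : ∀ {n} (X Y : VSet n) v → (∀ w → X w ≡ true → Y w ≡ true) → X v ≡ false → Y v ≡ true →
  size X < size Y
⊂⇒size< X Y v X⊆Y v∉X v∈Y = ∑-mono-< (∈-allFin v) strict weak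
  where
  strict : χ (X v) < χ (Y v)
  strict rewrite v∉X | v∈Y = ≤-refl
  weak : ∀ w → χ (X w) ≤ χ (Y w)
  weak w with X w in w∈X
  ... | false = z≤n
  ... | true rewrite X⊆Y w w∈X = ≤-refl

count : ∀ {n} → List (VSet n) → Fin n → ℕ
count L v = ∑ L (λ X → χ (X v))

level : ∀ {n} → ℕ → (Fin n → ℕ) → VSet n
level j c v = ⌊ j ≤? c v ⌋

⌊≤?⌋-true : ∀ {j c} → j ≤ c → ⌊ j ≤? c ⌋ ≡ true
⌊≤?⌋-true {j} {c} j≤c with j ≤? c
... | yes _   = refl
... | no j≰c  = contradiction j≤c j≰c

⌊≤?⌋-false : ∀ {j c} → c < j → ⌊ j ≤? c ⌋ ≡ false
⌊≤?⌋-false {j} {c} c<j with j ≤? c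
... | yes j≤c = contradiction c<j (≤⇒≯ j≤c)
... | no _    = refl

⌊≤?⌋-suc : ∀ {j c} → suc c ≢ j → ⌊ j ≤? suc c ⌋ ≡ ⌊ j ≤? c ⌋
⌊≤?⌋-suc {j} {c} 1+c≢j with j ≤? c
... | yes j≤c = ⌊≤?⌋-true (m≤n⇒m≤1+n j≤c)
... | no j≰c  = ⌊≤?⌋-false (≤∧≢⇒< (≰⇒> j≰c) 1+c≢j)

⌊s≤?s⌋ : ∀ j c → ⌊ suc j ≤? suc c ⌋ ≡ ⌊ j ≤? c ⌋
⌊s≤?s⌋ j c with j ≤? c
... | yes j≤c = ⌊≤?⌋-true (s≤s j≤c)
... | no j≰c  = ⌊≤?⌋-false (s≤s (≰⇒> j≰c))

extract : ∀ {A : Set} {P : A → Set} {xs} → Any P xs → ∃[ x ] ∃[ ys ] P x × xs ↭ x ∷ ys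
extract {xs = x ∷ xs} (here px) = x , xs , px , ↭-refl
extract {xs = x ∷ xs} (there p) with y , ys , py , xs↭ ← extract p =
  y , x ∷ ys , py , ↭-trans (prep x xs↭) (swap x y ↭-refl)

module Crossing {n : ℕ} (T : VSet n → Set)
  (uncross : ∀ {X Y} → T X → T Y → (∃[ v ] (X ∩ Y) v ≡ true) → (∃[ v ] (X ∪ Y) v ≡ false) →
             T (X ∩ Y) × T (X ∪ Y))
  where

  side : Bool → VSet n → VSet n
  side true  X = X
  side false X = ∁ X

  ConstantOn : VSet n → VSet n → Set
  ConstantOn M Y = ∀ {v w} → M v ≡ true → M w ≡ true → Y v ≡ Y w

  Splits : VSet n → VSet n → Set
  Splits M Y = ∃[ v ] ∃[ w ] M v ≡ true × M w ≡ true × Y v ≡ true × Y w ≡ false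

  splits? : ∀ M Y → Dec (Splits M Y)
  splits? M Y = any? λ v → any? λ w → (M v Bool.≟ true) ×-dec (M w Bool.≟ true)
    ×-dec (Y v Bool.≟ true) ×-dec (Y w Bool.≟ false)

  ¬Splits⇒ConstantOn : ∀ {M Y} → ¬ Splits M Y → ConstantOn M Y
  ¬Splits⇒ConstantOn {M} {Y} ¬split {v} {w} v∈M w∈M with Y v in Yv | Y w in Yw
  ... | true  | true  = refl
  ... | false | false = refl
  ... | true  | false = contradiction (v , w , v∈M , w∈M , Yv , Yw) ¬split
  ... | false | true  = contradiction (w , v , w∈M , v∈M , Yw , Yv) ¬split

  count-constant : ∀ {M L} → All (ConstantOn M) L → ∀ {v w} → M v ≡ true → M w ≡ true →
    count L v ≡ count L w
  count-constant []       v∈M w∈M = refl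
  count-constant (c ∷ cs) v∈M w∈M = cong₂ _+_ (cong χ (c v∈M w∈M)) (count-constant cs v∈M w∈M)

  -- Every member of rest contains or avoids the whole of leaf (or of its complement), so removing
  -- leaf from the list changes a single level set, by exactly that set.
  record Peeled (ℓ : ℕ) (c : Fin n → ℕ) : Set where
    field
      leaf     : VSet n
      inside   : Bool
      rest     : List (VSet n)
      T-leaf   : T leaf
      T-rest   : All T rest
      length-≡ : length rest ≡ ℓ
      count-≡  : ∀ v → c v ≡ count (leaf ∷ rest) v
      constant : All (ConstantOn (side inside leaf)) rest

  -- One uncrossing move. Multiplicities are preserved; the decreasing measure is the size of a
  -- chosen side, which may switch between a set and its complement.
  record Smaller (b : Bool) (X Y : VSet n) : Set where
    field
      X′ Y′   : VSet n
      inside  : Bool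
      T-X′    : T X′
      T-Y′    : T Y′
      size-<  : size (side inside X′) < size (side b X)
      count-≡ : ∀ v → χ (X v) + χ (Y v) ≡ χ (X′ v) + χ (Y′ v)

  -- If `X` and `Y` cross, they are replaced by intersection and union; the intersection shrinks
  -- `X`, the union shrinks its complement. The split already supplies one of the two conditions for
  -- uncrossing. If the other fails, the complement of `Y` lies properly inside `X`, or `Y` lies
  -- properly inside the complement of `X`, and exchanging the two sets suffices.
  shrink : ∀ b {X Y} → T X → T Y → Splits (side b X) Y → Smaller b X Y
  shrink true {X} {Y} tX tY (v , w , v∈X , w∈X , v∈Y , w∉Y) with any? (λ z → (X ∪ Y) z Bool.≟ false)
  ... | yes outside with t∩ , t∪ ← uncross tX tY (v , cong₂ _∧_ v∈X v∈Y) outside = record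
    { X′ = X ∩ Y ; Y′ = X ∪ Y ; inside = true ; T-X′ = t∩ ; T-Y′ = t∪
    ; size-< = ⊂⇒size< (X ∩ Y) X w sub (cong₂ _∧_ w∈X w∉Y) w∈X
    ; count-≡ = λ z → sym (χ-∩∪ (X z) (Y z)) }
    where
    sub : ∀ z → (X ∩ Y) z ≡ true → X z ≡ true
    sub z p with X z
    ... | true = refl
  ... | no covered = record
    { X′ = Y ; Y′ = X ; inside = false ; T-X′ = tY ; T-Y′ = tX
    ; size-< = ⊂⇒size< (∁ Y) X v sub (cong not v∈Y) v∈X
    ; count-≡ = λ z → +-comm (χ (X z)) (χ (Y z)) }
    where
    sub : ∀ z → ∁ Y z ≡ true → X z ≡ true
    sub z p with X z in Xz | Y z in Yz
    ... | true  | _     = refl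
    ... | false | false = contradiction (z , cong₂ _∨_ Xz Yz) covered
  shrink false {X} {Y} tX tY (v , w , v∉X , w∉X , v∈Y , w∉Y) with any? (λ z → (X ∩ Y) z Bool.≟ true)
  ... | yes common with t∩ , t∪ ← uncross tX tY common (w , cong₂ _∨_ (not-injective w∉X) w∉Y) = record
    { X′ = X ∪ Y ; Y′ = X ∩ Y ; inside = false ; T-X′ = t∪ ; T-Y′ = t∩
    ; size-< = ⊂⇒size< (∁ (X ∪ Y)) (∁ X) v sub (cong not (∨-introʳ (X v) v∈Y)) v∉X
    ; count-≡ = λ z → trans (sym (χ-∩∪ (X z) (Y z))) (+-comm (χ (X z ∧ Y z)) _) }
    where
    sub : ∀ z → ∁ (X ∪ Y) z ≡ true → ∁ X z ≡ true
    sub z p with X z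
    ... | false = refl
  ... | no disjoint = record
    { X′ = Y ; Y′ = X ; inside = true ; T-X′ = tY ; T-Y′ = tX
    ; size-< = ⊂⇒size< Y (∁ X) w sub w∉Y w∉X
    ; count-≡ = λ z → +-comm (χ (X z)) (χ (Y z)) }
    where
    sub : ∀ z → Y z ≡ true → ∁ X z ≡ true
    sub z z∈Y with X z in Xz
    ... | false = refl
    ... | true  = contradiction (z , cong₂ _∧_ Xz z∈Y) disjoint

  -- While some member splits the chosen side, `shrink` leads to a strictly smaller side, so one
  -- that no member splits is reached. The fuel bounds the size of the side.
  peel : ∀ fuel b X L → size (side b X) < fuel → T X → All T L → Peeled (length L) (count (X ∷ L))
  peel (suc fuel) b X L (s≤s size≤) tX tL with Any.any? (splits? (side b X)) L
  ... | no ¬split = record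
    { leaf = X ; inside = b ; rest = L ; T-leaf = tX ; T-rest = tL ; length-≡ = refl
    ; count-≡ = λ _ → refl
    ; constant = All.map ¬Splits⇒ConstantOn (All.¬Any⇒All¬ L ¬split) }
  ... | yes split with Y , L′ , Y-splits , L↭ ← extract split
    with tY ∷ tL′ ← All-resp-↭ L↭ tL = result
    where
    open Smaller (shrink b tX tY Y-splits)
    module P = Peeled (peel fuel inside X′ (Y′ ∷ L′) (<-≤-trans size-< size≤) T-X′ (T-Y′ ∷ tL′))
    same : ∀ v → count (X ∷ L) v ≡ count (X′ ∷ Y′ ∷ L′) v
    same v = begin
      χ (X v) + count L v                   ≡⟨ cong (_+_ (χ (X v))) (∑-↭ (λ Z → χ (Z v)) L↭) ⟩
      χ (X v) + (χ (Y v) + count L′ v)      ≡⟨ +-assoc (χ (X v)) _ _ ⟨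
      χ (X v) + χ (Y v) + count L′ v        ≡⟨ cong (_+ count L′ v) (count-≡ v) ⟩
      χ (X′ v) + χ (Y′ v) + count L′ v      ≡⟨ +-assoc (χ (X′ v)) _ _ ⟩
      χ (X′ v) + (χ (Y′ v) + count L′ v)    ∎
      where open ≡-Reasoning
    result : Peeled (length L) (count (X ∷ L))
    result = record
      { leaf = P.leaf ; inside = P.inside ; rest = P.rest ; T-leaf = P.T-leaf ; T-rest = P.T-rest
      ; length-≡ = trans P.length-≡ (sym (↭-length L↭))
      ; count-≡ = λ v → trans (same v) (P.count-≡ v)
      ; constant = P.constant }

  module _ (x y : Fin n → ℕ) (x≤y : ∀ {X} → T X → mass x X ≤ mass y X)
    (total : mass x (λ _ → true) ≡ mass y (λ _ → true)) where

    private
      Good : VSet n → Set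
      Good X = mass x X ≤ mass y X

      Good-resp : ∀ {X Y : VSet n} → (∀ v → X v ≡ Y v) → Good X → Good Y
      Good-resp X≗Y = subst₂ _≤_ (mass-cong X≗Y) (mass-cong X≗Y)

      Good-⊎ : ∀ {X Y Z : VSet n} → (∀ v → χ (X v) + χ (Y v) ≡ χ (Z v)) → Good X → Good Y → Good Z
      Good-⊎ X⊎Y≗Z gX gY = subst₂ _≤_ (mass-⊎ X⊎Y≗Z) (mass-⊎ X⊎Y≗Z) (+-mono-≤ gX gY)

      mass-∁ : ∀ {X} → T X → mass y (∁ X) ≤ mass x (∁ X)
      mass-∁ {X} tX = +-cancelˡ-≤ (mass y X) _ _ (begin
        mass y X + mass y (∁ X) ≡⟨ mass-⊎ {x = y} {X} (λ v → χ-∁ (X v)) ⟩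
        mass y (λ _ → true)     ≡⟨ total ⟨
        mass x (λ _ → true)     ≡⟨ mass-⊎ {x = x} {X} (λ v → χ-∁ (X v)) ⟨
        mass x X + mass x (∁ X) ≤⟨ +-monoˡ-≤ _ (x≤y tX) ⟩
        mass y X + mass x (∁ X) ∎)
        where open ≤-Reasoning

      Good-∖ : ∀ {X Y Z : VSet n} → T X → (∀ v → χ (Z v) + χ (∁ X v) ≡ χ (Y v)) → Good Y → Good Z
      Good-∖ {X} {Y} {Z} tX Z⊎∁X≗Y gY = +-cancelʳ-≤ (mass x (∁ X)) _ _ (begin
        mass x Z + mass x (∁ X) ≡⟨ mass-⊎ {x = x} {Z} Z⊎∁X≗Y ⟩
        mass x Y                ≤⟨ gY ⟩
        mass y Y                ≡⟨ mass-⊎ {x = y} {Z} Z⊎∁X≗Y ⟨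
        mass y Z + mass y (∁ X) ≤⟨ +-monoʳ-≤ (mass y Z) (mass-∁ tX) ⟩
        mass y Z + mass x (∁ X) ∎)
        where open ≤-Reasoning

      -- Let c₀ be the value of `c` on the chosen side. If the side is `X`, only level c₀ + 1
      -- changes, and it gains exactly `X`. If it is the complement, adding `X` amounts to raising
      -- `c` by one everywhere and lowering it back on the complement: each level becomes the
      -- preceding level of `c`, except that level c₀ + 1 is level c₀ of `c` without the complement
      -- of `X`, a removal that `mass-∁` permits.
      add-leaf : ∀ b {X c} → T X → (∀ {v w} → side b X v ≡ true → side b X w ≡ true → c v ≡ c w) →
        (∀ j → Good (level j c)) → ∀ j → Good (level j (λ v → χ (X v) + c v))
      add-leaf true {X} {c} tX const good j with any? (λ v → (X v Bool.≟ true) ×-dec (suc (c v) ℕ.≟ j))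
      ... | no none = Good-resp same (good j)
        where
        same : ∀ v → level j c v ≡ level j (λ v → χ (X v) + c v) v
        same v with X v in v∈X
        ... | false = refl
        ... | true  = sym (⌊≤?⌋-suc (λ eq′ → none (v , v∈X , eq′)))
      ... | yes (w , w∈X , refl) = Good-⊎ split (good j) (x≤y tX)
        where
        split : ∀ v → χ (level j c v) + χ (X v) ≡ χ (level j (λ v → χ (X v) + c v) v)
        split v with X v in v∈X
        ... | false = +-identityʳ _
        ... | true rewrite const v∈X w∈X | ⌊≤?⌋-false {suc (c w)} {c w} ≤-refl
                         | ⌊≤?⌋-true {suc (c w)} {suc (c w)} ≤-refl = refl
      -- Level zero is the whole vertex set and has no preceding level to be compared with.
      add-leaf false {X} {c} tX const good zero = ≤-reflexive total
      add-leaf false {X} {c} tX const good (suc j) with any? (λ v → (∁ X v Bool.≟ true) ×-dec (c v ℕ.≟ j))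
      ... | no none = Good-resp same (good j)
        where
        same : ∀ v → level j c v ≡ level (suc j) (λ v → χ (X v) + c v) v
        same v with X v in v∈X
        ... | true  = sym (⌊s≤?s⌋ j (c v))
        ... | false = trans (sym (⌊s≤?s⌋ j (c v))) (⌊≤?⌋-suc λ eq′ → none (v , cong not v∈X , suc-injective eq′))
      ... | yes (w , w∉X , refl) = Good-∖ tX split (good j)
        where
        split : ∀ v → χ (level (suc j) (λ v → χ (X v) + c v) v) + χ (∁ X v) ≡ χ (level j c v)
        split v with X v in v∈X
        ... | true  = trans (+-identityʳ _) (cong χ (⌊s≤?s⌋ j (c v)))
        ... | false rewrite const {v} {w} (cong not v∈X) w∉X | ⌊≤?⌋-false {suc (c w)} {c w} ≤-refl
                          | ⌊≤?⌋-true {c w} {c w} ≤-refl = refl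

    -- `peel` rewrites the list without changing multiplicities, and `add-leaf` puts the leaf back.
    -- The remaining list need not be a sublist of `L`, so the recursion is on the length.
    level-mass : ∀ ℓ L → length L ≡ ℓ → All T L → ∀ j → mass x (level j (count L)) ≤ mass y (level j (count L))
    level-mass zero    []      refl [] zero    = ≤-reflexive total
    level-mass zero    []      refl [] (suc j) = ≤-reflexive
      (trans (∑-zero (allFin n)) (sym (∑-zero (allFin n))))
    level-mass (suc ℓ) (X ∷ L) len (tX ∷ tL) j =
      Good-resp (λ v → cong (λ c → ⌊ j ≤? c ⌋) (sym (count-≡ v)))
        (add-leaf inside T-leaf (count-constant constant) (level-mass ℓ rest (trans length-≡ (suc-injective len)) T-rest) j)
      where open Peeled (peel _ true X L ≤-refl tX tL)

    private
      Separator : Fin n → Fin n → Set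
      Separator t s = ∃[ X ] T X × X t ≡ true × X s ≡ false

      merge : ∀ b d {c} → χ d + c ≤ 1 → χ (b ∨ d) ⊔ c ≡ χ b ⊔ (χ d + c)
      merge true  d     {c} le = trans (m≥n⇒m⊔n≡m (≤-trans (m≤n+m c (χ d)) le)) (sym (m≥n⇒m⊔n≡m le))
      merge false true  {zero} le = refl
      merge false true  {suc c} (s≤s ())
      merge false false le = refl

      -- The list consists of disjoint sets avoiding `s`. Members that meet `X` are absorbed into
      -- it; the unions stay in `T` because `s` remains outside. The maximum `⊔` says that the union
      -- of the list grows by `X` while its members stay disjoint.
      insert : ∀ s X L → T X → All T L → X s ≡ false → count L s ≡ 0 → (∀ v → count L v ≤ 1) →
        ∃[ L′ ] All T L′ × (∀ v → count L′ v ≡ χ (X v) ⊔ count L v)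
      insert s X [] tX [] s∉X _ _ = X ∷ [] , tX ∷ [] , λ v → trans (+-identityʳ _) (sym (⊔-identityʳ _))
      insert s X (Y ∷ L) tX (tY ∷ tL) s∉X none ≤1
        with any? (λ v → (X ∩ Y) v Bool.≟ true)
      ... | yes common with s∉X∪Y ← cong₂ _∨_ s∉X (χ≡0⇒false (m+n≡0⇒m≡0 (χ (Y s)) none))
        with L′ , tL′ , count≡ ← insert s (X ∪ Y) L
                (proj₂ (uncross tX tY common (s , s∉X∪Y))) tL s∉X∪Y (m+n≡0⇒n≡0 (χ (Y s)) none)
                (λ v → ≤-trans (m≤n+m _ (χ (Y v))) (≤1 v))
        = L′ , tL′ , λ v → trans (count≡ v) (merge (X v) (Y v) (≤1 v))
      ... | no disjoint with L′ , tL′ , count≡ ← insert s X L tX tL s∉X (m+n≡0⇒n≡0 (χ (Y s)) none)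
                (λ v → ≤-trans (m≤n+m _ (χ (Y v))) (≤1 v))
        = Y ∷ L′ , tY ∷ tL′ , λ v → trans (cong (_+_ (χ (Y v))) (count≡ v)) (apart v)
        where
        apart : ∀ v → χ (Y v) + (χ (X v) ⊔ count L v) ≡ χ (X v) ⊔ (χ (Y v) + count L v)
        apart v with X v in Xv | Y v in Yv
        ... | true  | true  = contradiction (v , cong₂ _∧_ Xv Yv) disjoint
        ... | true  | false = refl
        ... | false | _     = refl

      cover : ∀ s ts → (∀ {t} → t ∈ ts → Separator t s) →
        ∃[ L ] All T L × (∀ v → count L v ≤ 1) × count L s ≡ 0 × (∀ {t} → t ∈ ts → count L t ≡ 1)
      cover s []       sep = [] , [] , (λ _ → z≤n) , refl , λ ()
      cover s (t ∷ ts) sep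
        with X , tX , t∈X , s∉X ← sep (here refl)
           | L , tL , ≤1 , none , hit ← cover s ts (sep ∘ there)
        with L′ , tL′ , count≡ ← insert s X L tX tL s∉X none ≤1
        = L′ , tL′ , (λ v → subst (_≤ 1) (sym (count≡ v)) (⊔-lub (χ≤1 (X v)) (≤1 v)))
        , trans (count≡ s) (cong₂ _⊔_ (χ-false s∉X) none)
        , λ { (here refl) → trans (count≡ t) (trans (cong (_⊔ count L t) (χ-true t∈X)) (m≥n⇒m⊔n≡m (≤1 t)))
            ; (there {u} u∈ts) → trans (count≡ _) (trans (cong (χ (X _) ⊔_) (hit u∈ts)) (m≤n⇒m⊔n≡n (χ≤1 (X _)))) }

      -- The covers for the single elements of `ss` are concatenated. Each `t` lies in all of them,
      -- whereas each `s` is missed by its own cover and counted at most once by any other.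
      covers : ∀ ts ss → (∀ {t s} → t ∈ ts → s ∈ ss → Separator t s) →
        ∃[ L ] All T L × (∀ v → count L v ≤ length ss) × (∀ {t} → t ∈ ts → count L t ≡ length ss)
                       × (∀ {s} → s ∈ ss → count L s < length ss)
      covers ts []       sep = [] , [] , (λ _ → z≤n) , (λ _ → refl) , λ ()
      covers ts (s ∷ ss) sep
        with L , tL , ≤1 , none , hit ← cover s ts (λ t∈ts → sep t∈ts (here refl))
           | L′ , tL′ , ≤ss , hits , misses ← covers ts ss (λ t∈ts s∈ss → sep t∈ts (there s∈ss))
        = L ++ L′ , All.++⁺ tL tL′
        , (λ v → subst (_≤ _) (sym (count-++ v)) (+-mono-≤ (≤1 v) (≤ss v)))
        , (λ {t} t∈ts → trans (count-++ t) (cong₂ _+_ (hit t∈ts) (hits t∈ts)))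
        , λ { (here refl) → s≤s (subst (_≤ _) (sym (trans (count-++ s) (cong (_+ count L′ s) none))) (≤ss s))
            ; (there {u} u∈ss) → subst (_< _) (sym (count-++ _)) (+-mono-≤-< (≤1 _) (misses u∈ss)) }
        where
        count-++ : ∀ v → count (L ++ L′) v ≡ count L v + count L′ v
        count-++ v = ∑-++ (λ X → χ (X v)) L L′

    separate : ∀ ts ss → (∀ {t s} → t ∈ ts → s ∈ ss → ∃[ X ] T X × X t ≡ true × X s ≡ false) →
      ∃[ Z ] (∀ {t} → t ∈ ts → Z t ≡ true) × (∀ {s} → s ∈ ss → Z s ≡ false) × mass x Z ≤ mass y Z
    separate ts ss sep with L , tL , _ , hits , misses ← covers ts ss sep =
      -- The top level. For empty `ss` it is the whole vertex set.
      level (length ss) (count L)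
      , (λ t∈ts → ⌊≤?⌋-true (≤-reflexive (sym (hits t∈ts))))
      , (λ s∈ss → ⌊≤?⌋-false (misses s∈ss))
      , level-mass _ L refl tL (length ss)

-- In-degrees and tight sets

module _ {n m : ℕ} (E : Edges n m) (loopless : Loopless E) where

  hd≢tl : ∀ D i → hd E D i ≢ tl E D i
  hd≢tl D i with D i
  ... | true  = loopless i ∘ sym
  ... | false = loopless i

  -- Double counting; without loops, every arc with head `v` enters the singleton of `v`.
  mass-indeg : ∀ D X → mass (indeg E D) X ≡ ∑ (allFin m) (λ i → χ (X (hd E D i)))
  mass-indeg D X = begin
    mass (indeg E D) X
      ≡⟨ ∑-cong (allFin n) distribute ⟩
    ∑ (allFin n) (λ v → ∑ (allFin m) (λ i → if ⌊ v ≟ hd E D i ⌋ then χ (X v) else 0))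
      ≡⟨ ∑-swap (λ v i → if ⌊ v ≟ hd E D i ⌋ then χ (X v) else 0) (allFin n) (allFin m) ⟩
    ∑ (allFin m) (λ i → ∑ (allFin n) (λ v → if ⌊ v ≟ hd E D i ⌋ then χ (X v) else 0))
      ≡⟨ ∑-cong (allFin m) (λ i → ∑-indicator (χ ∘ X) (hd E D i)) ⟩
    ∑ (allFin m) (λ i → χ (X (hd E D i))) ∎
    where
    open ≡-Reasoning
    arc : ∀ v {h t} → h ≢ t → X v ≡ true →
      χ (⌊ h ≟ v ⌋ ∧ not ⌊ t ≟ v ⌋) ≡ (if ⌊ v ≟ h ⌋ then χ (X v) else 0)
    arc v {h} {t} h≢t v∈X with h ≟ v | t ≟ v | v ≟ h
    ... | yes refl | yes refl | _        = contradiction refl h≢t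
    ... | yes refl | no _     | yes _    = sym (χ-true v∈X)
    ... | yes refl | no _     | no v≢v   = contradiction refl v≢v
    ... | no h≢h   | _        | yes refl = contradiction refl h≢h
    ... | no _     | _        | no _     = refl
    outside : ∀ b {c} → c ≡ false → (if b then χ c else 0) ≡ 0
    outside true  refl = refl
    outside false refl = refl
    distribute : ∀ v → (if X v then indeg E D v else 0)
                     ≡ ∑ (allFin m) (λ i → if ⌊ v ≟ hd E D i ⌋ then χ (X v) else 0)
    distribute v = go (X v) refl
      where
      go : ∀ b → X v ≡ b → (if b then indeg E D v else 0)
                     ≡ ∑ (allFin m) (λ i → if ⌊ v ≟ hd E D i ⌋ then χ (X v) else 0)
      go true  v∈X = ∑-cong (allFin m) (λ i → arc v (hd≢tl D i) v∈X)
      go false v∉X = sym (trans (∑-cong (allFin m) (λ i → outside ⌊ v ≟ hd E D i ⌋ v∉X)) (∑-zero (allFin m)))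

  -- mass (indeg E D) X minus ρ E D X counts the edges induced by X, whatever the orientation D.
  mass-ρ : ∀ D D′ X → mass (indeg E D) X + ρ E D′ X ≡ mass (indeg E D′) X + ρ E D X
  mass-ρ D D′ X = begin
    mass (indeg E D) X + ρ E D′ X   ≡⟨ cong (_+ ρ E D′ X) (mass-indeg D X) ⟩
    _ + ρ E D′ X                    ≡⟨ ∑-cong-+ (allFin m) (λ i → arc (proj₁ (E i)) (proj₂ (E i)) (D i) (D′ i)) ⟩
    _ + ρ E D X                     ≡⟨ cong (_+ ρ E D X) (mass-indeg D′ X) ⟨
    mass (indeg E D′) X + ρ E D X   ∎
    where
    open ≡-Reasoning
    arc : ∀ p q b b′ →
      χ (X (if b then q else p)) + χ (X (if b′ then q else p) ∧ not (X (if b′ then p else q))) ≡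
      χ (X (if b′ then q else p)) + χ (X (if b then q else p) ∧ not (X (if b then p else q)))
    arc p q true  true  = refl
    arc p q false false = refl
    arc p q true  false with X p | X q
    ... | true  | true  = refl
    ... | true  | false = refl
    ... | false | true  = refl
    ... | false | false = refl
    arc p q false true with X p | X q
    ... | true  | true  = refl
    ... | true  | false = refl
    ... | false | true  = refl
    ... | false | false = refl

  mass-total : ∀ D D′ → mass (indeg E D) (λ _ → true) ≡ mass (indeg E D′) (λ _ → true)
  mass-total D D′ = +-cancelʳ-≡ _ _ _ (trans (mass-ρ D D′ (λ _ → true)) (cong (_+_ (mass (indeg E D′) (λ _ → true)))
    (trans (∑-zero (allFin m)) (sym (∑-zero (allFin m))))))

module _ {n m : ℕ} (E : Edges n m) (D : Orientation m) where

  ρ-submodular : ∀ X Y → ρ E D (X ∩ Y) + ρ E D (X ∪ Y) ≤ ρ E D X + ρ E D Y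
  ρ-submodular X Y = ∑-mono-+ (allFin m) (λ i → arc (X (hd E D i)) (X (tl E D i)) (Y (hd E D i)) (Y (tl E D i)))
    where
    arc : ∀ a b c d → χ ((a ∧ c) ∧ not (b ∧ d)) + χ ((a ∨ c) ∧ not (b ∨ d)) ≤ χ (a ∧ not b) + χ (c ∧ not d)
    arc true  true  true  true  = z≤n
    arc true  true  true  false = ≤-refl
    arc true  true  false d     = z≤n
    arc true  false true  true  = ≤-refl
    arc true  false true  false = ≤-refl
    arc true  false false true  = z≤n
    arc true  false false false = ≤-refl
    arc false true  true  true  = z≤n
    arc false true  true  false = z≤n
    arc false true  false d     = z≤n
    arc false false true  true  = z≤n
    arc false false true  false = ≤-refl
    arc false false false d     = z≤n

  -- Only the upper bound is recorded; k-edge-connectivity supplies the lower one.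
  Tight : ℕ → VSet n → Set
  Tight k X = ρ E D X ≤ k × (∃[ v ] X v ≡ true) × (∃[ v ] X v ≡ false)

  -- By submodularity the two in-degrees sum to at most 2k, and each is at least k, so neither
  -- exceeds k.
  tight-uncross : ∀ {k} → KEdgeConnected k E D → ∀ {X Y} → Tight k X → Tight k Y →
    (∃[ v ] (X ∩ Y) v ≡ true) → (∃[ v ] (X ∪ Y) v ≡ false) → Tight k (X ∩ Y) × Tight k (X ∪ Y)
  tight-uncross {k} conn {X} {Y} (ρX≤k , _) (ρY≤k , _) in∩@(v , v∈∩) out∪@(w , w∉∪) =
    (+-cancelʳ-≤ k _ _ (≤-trans (+-monoʳ-≤ _ (conn (X ∪ Y) in∪ out∪)) sum≤) , in∩ , out∩) ,
    (+-cancelˡ-≤ k _ _ (≤-trans (+-monoˡ-≤ _ (conn (X ∩ Y) in∩ out∩)) sum≤) , in∪ , out∪)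
    where
    sum≤ : ρ E D (X ∩ Y) + ρ E D (X ∪ Y) ≤ k + k
    sum≤ = ≤-trans (ρ-submodular X Y) (+-mono-≤ ρX≤k ρY≤k)
    in∪ : ∃[ v ] (X ∪ Y) v ≡ true
    in∪ = v , ∧⇒∨ (X v) v∈∩
      where
      ∧⇒∨ : ∀ a {b} → a ∧ b ≡ true → a ∨ b ≡ true
      ∧⇒∨ true _ = refl
    out∩ : ∃[ v ] (X ∩ Y) v ≡ false
    out∩ = w , ¬∨⇒¬∧ (X w) w∉∪
      where
      ¬∨⇒¬∧ : ∀ a {b} → a ∨ b ≡ false → a ∧ b ≡ false
      ¬∨⇒¬∧ false _ = refl

-- Sufficiency and necessity

<+suc⇒≤+ : ∀ {i c} → i ℤ.< + suc c → i ℤ.≤ + c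
<+suc⇒≤+ (ℤ.+<+ (s≤s i≤c)) = ℤ.+≤+ i≤c
<+suc⇒≤+ ℤ.-<+             = ℤ.-≤+

module _ {n m : ℕ} (E : Edges n m) (k : ℕ) (f g : Fin n → ℤ) where

  ImprovingPair : Orientation m → Set
  ImprovingPair D = ∃[ s ] ∃[ t ]
    ((+ indeg E D s ℤ.+ + 2 ℤ.≤ + indeg E D t)
    × (f t ℤ.< + indeg E D t)
    × (+ indeg E D s ℤ.< g s)
    × ArcDisjointPaths (suc k) E D s t)

  module _ (loopless : Loopless E) {D D′ : Orientation m}
    (feasible : Feasible k f g E D) (feasible′ : Feasible k f g E D′) (¬improving : ¬ ImprovingPair D) where

    private
      x y : Fin n → ℕ
      x = indeg E D
      y = indeg E D′

      -- The same number of edges is induced by `X` in both orientations, while at most `k` arcs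
      -- enter `X` in `D` and at least `k` in `D′`.
      tight-mass : ∀ {X} → Tight E D k X → mass x X ≤ mass y X
      tight-mass {X} (ρX≤k , inX , outX) = +-cancelʳ-≤ (ρ E D′ X) _ _ (begin
        mass x X + ρ E D′ X ≡⟨ mass-ρ E loopless D D′ X ⟩
        mass y X + ρ E D X  ≤⟨ +-monoʳ-≤ (mass y X) (≤-trans ρX≤k (proj₁ feasible′ X inX outX)) ⟩
        mass y X + ρ E D′ X ∎)
        where open ≤-Reasoning

      module _ (j : ℕ) where

        High Low : Fin n → Set
        High v = j < x v × f v ℤ.< + x v
        Low  v = x v < j × + x v ℤ.< g v

        high? : ∀ v → Dec (High v)
        high? v = (j <? x v) ×-dec (f v ℤ.<? + x v)

        low? : ∀ v → Dec (Low v)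
        low? v = (x v <? j) ×-dec (+ x v ℤ.<? g v)

        -- In-degrees strictly on opposite sides of `j` differ by at least 2, so k + 1 disjoint
        -- paths would form an improving pair; Menger's theorem then leaves only a small cut.
        tight-separator : ∀ {t s} → High t → Low s → ∃[ X ] Tight E D k X × X t ≡ true × X s ≡ false
        tight-separator {t} {s} (j<xt , ft<xt) (xs<j , xs<gs) with menger E k D s t
        ... | inj₂ (X , t∈X , s∉X , ρX≤k) = X , (ρX≤k , (t , t∈X) , (s , s∉X)) , t∈X , s∉X
        ... | inj₁ paths = contradiction (s , t , ℤ.+≤+ gap , ft<xt , xs<gs , paths) ¬improving
          where
          gap : x s + 2 ≤ x t
          gap = ≤-trans (≤-reflexive (+-comm (x s) 2)) (≤-trans (s≤s xs<j) j<xt)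

        -- The contribution of one vertex to the inequality in `excess-≤`, with `z` telling whether
        -- it lies in Z.
        exchange : ∀ a b (z : Bool) → (z ≡ true → j ≤ a ⊎ (a ≤ j × b ≤ a)) → (z ≡ false → a ≤ j ⊎ a ≤ b) →
          (a ∸ j) + (if z then b else 0) ≤ (b ∸ j) + (if z then a else 0)
        exchange a b true inside _ with inside refl
        ... | inj₁ j≤a = begin
          (a ∸ j) + b             ≤⟨ +-monoʳ-≤ (a ∸ j) (m≤n+m∸n b j) ⟩
          (a ∸ j) + (j + (b ∸ j)) ≡⟨ +-assoc (a ∸ j) j (b ∸ j) ⟨
          (a ∸ j) + j + (b ∸ j)   ≡⟨ cong (_+ (b ∸ j)) (m∸n+n≡m j≤a) ⟩
          a + (b ∸ j)             ≡⟨ +-comm a (b ∸ j) ⟩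
          (b ∸ j) + a             ∎
          where open ≤-Reasoning
        ... | inj₂ (a≤j , b≤a) rewrite m≤n⇒m∸n≡0 a≤j = ≤-trans b≤a (m≤n+m a (b ∸ j))
        exchange a b false _ outside with outside refl
        ... | inj₁ a≤j rewrite m≤n⇒m∸n≡0 a≤j = z≤n
        ... | inj₂ a≤b = +-monoˡ-≤ 0 (∸-monoˡ-≤ j a≤b)

        -- The bound on Z makes the comparison local: once x(Z) is added on both sides and enlarged
        -- to y(Z) on the left, the inequality holds at each vertex.
        excess-≤ : ∑ (allFin n) (λ v → x v ∸ j) ≤ ∑ (allFin n) (λ v → y v ∸ j)
        excess-≤ with Z , high⊆Z , low⊆∁Z , Z-mass ←
          Crossing.separate (Tight E D k) (tight-uncross E D (proj₁ feasible)) x y tight-mass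
            (mass-total E loopless D D′) (filter high? (allFin n)) (filter low? (allFin n))
            (λ t∈ s∈ → tight-separator (proj₂ (∈-filter⁻ high? {xs = allFin n} t∈)) (proj₂ (∈-filter⁻ low? {xs = allFin n} s∈)))
          = +-cancelʳ-≤ (mass x Z) _ _ (begin
            ∑ (allFin n) (λ v → x v ∸ j) + mass x Z ≤⟨ +-monoʳ-≤ (∑ (allFin n) (λ v → x v ∸ j)) Z-mass ⟩
            ∑ (allFin n) (λ v → x v ∸ j) + mass y Z ≤⟨ ∑-mono-+ (allFin n) (λ v → exchange (x v) (y v) (Z v) (inside v) (outside v)) ⟩
            ∑ (allFin n) (λ v → y v ∸ j) + mass x Z ∎)
          where
          open ≤-Reasoning
          inside : ∀ v → Z v ≡ true → j ≤ x v ⊎ (x v ≤ j × y v ≤ x v)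
          inside v v∈Z with j ≤? x v | + x v ℤ.<? g v
          ... | yes j≤xv | _        = inj₁ j≤xv
          ... | no j≰xv  | yes xv<g = ⊥-elim (true≢false v∈Z
                (low⊆∁Z (∈-filter⁺ low? (∈-allFin v) (≰⇒> j≰xv , xv<g))))
          -- Here x has reached the upper bound `g`, which y respects.
          ... | no j≰xv  | no xv≮g  = inj₂ (<⇒≤ (≰⇒> j≰xv) ,
                ℤ.drop‿+≤+ (ℤ.≤-trans (proj₂ (proj₂ feasible′ v)) (ℤ.≮⇒≥ xv≮g)))
          outside : ∀ v → Z v ≡ false → x v ≤ j ⊎ x v ≤ y v
          outside v v∉Z with x v ≤? j | f v ℤ.<? + x v
          ... | yes xv≤j | _        = inj₁ xv≤j
          ... | no xv≰j  | yes f<xv = ⊥-elim (true≢false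
                (high⊆Z (∈-filter⁺ high? (∈-allFin v) (≰⇒> xv≰j , f<xv))) v∉Z)
          -- Here x is down at the lower bound `f`, which y respects.
          ... | no xv≰j  | no f≮xv  = inj₂
                (ℤ.drop‿+≤+ (ℤ.≤-trans (ℤ.≮⇒≥ f≮xv) (proj₁ (proj₂ feasible′ v))))

    ¬improving⇒LexLeq : LexLeq (sortedInDegs E D) (sortedInDegs E D′)
    ¬improving⇒LexLeq = excess≤⇒LexLeq _ _
      (trans (sortedInDegs-length E D) (sym (sortedInDegs-length E D′)))
      (sortedInDegs-descending E D′)
      (λ j → subst₂ _≤_ (sym (sortedInDegs-excess E D j)) (sym (sortedInDegs-excess E D′ j)) (excess-≤ j))

  module _ {D : Orientation m} (feasible : Feasible k f g E D) (minimal : DecMin k f g E D) where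

    -- Reversing the first path gives a feasible orientation whose in-degree vector is majorized by
    -- that of `D`, strictly at the threshold `y t`; minimality of `D` excludes the strict drop.
    DecMin⇒¬improving : ¬ ImprovingPair D
    DecMin⇒¬improving (s , t , gap , ft<xt , xs<gs , disjoint@(as ∷ _ , paths , _)) =
      <-irrefl refl (<-≤-trans strict (excess-≥ (y t)))
      where
      x y : Fin n → ℕ
      D′ = flip E as D
      x = indeg E D
      y = indeg E D′

      ρ-D′ : ∀ X → ρ E D′ X + χ (X t) ≡ ρ E D X + χ (X s)
      ρ-D′ = ρ-flip E (paths zero)

      2+xs≤xt : 2 + x s ≤ x t
      2+xs≤xt = ≤-trans (≤-reflexive (+-comm 2 (x s))) (ℤ.drop‿+≤+ gap)

      s≢t : s ≢ t
      s≢t refl = <-irrefl refl (≤-trans (n≤1+n _) 2+xs≤xt)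

      y-t : suc (y t) ≡ x t
      y-t with p ← ρ-D′ (singleton t) rewrite ⌊≟⌋-refl t | ⌊≟⌋-≢ s≢t =
        trans (+-comm 1 (y t)) (trans p (+-identityʳ (x t)))

      y-s : y s ≡ suc (x s)
      y-s with p ← ρ-D′ (singleton s) rewrite ⌊≟⌋-refl s | ⌊≟⌋-≢ (s≢t ∘ sym) =
        trans (sym (+-identityʳ (y s))) (trans p (+-comm (x s) 1))

      y-other : ∀ {v} → v ≢ s → v ≢ t → y v ≡ x v
      y-other {v} v≢s v≢t with p ← ρ-D′ (singleton v) rewrite ⌊≟⌋-≢ (v≢s ∘ sym) | ⌊≟⌋-≢ (v≢t ∘ sym) =
        +-cancelʳ-≡ 0 (y v) (x v) p

      connected′ : KEdgeConnected k E D′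
      connected′ X inX outX with p ← ρ-D′ X | q ← proj₁ feasible X inX outX
        with X t in t∈X | X s in s∈X
      ... | true  | true  = ≤-trans q (≤-reflexive (sym (+-cancelʳ-≡ 1 _ _ p)))
      ... | false | false = ≤-trans q (≤-reflexive (sym (+-cancelʳ-≡ 0 _ _ p)))
      ... | false | true  = ≤-trans q (≤-trans (m≤m+n _ 1) (≤-reflexive (trans (sym p) (+-identityʳ _))))
      -- The only cuts that lose an arc; they were entered by k + 1 disjoint paths.
      ... | true  | false = s≤s⁻¹ (≤-trans (paths-enter E disjoint X t∈X s∈X)
              (≤-reflexive (trans (sym (+-identityʳ _)) (trans (sym p) (+-comm _ 1)))))

      bounded′ : InDegConstrained f g E D′
      bounded′ v with v ≟ s | v ≟ t
      ... | yes refl | _ =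
              ℤ.≤-trans (proj₁ (proj₂ feasible v)) (ℤ.+≤+ (≤-trans (n≤1+n _) (≤-reflexive (sym y-s))))
            , subst (λ c → + c ℤ.≤ g v) (sym y-s) (ℤ.i<j⇒suc[i]≤j xs<gs)
      ... | no _ | yes refl =
              <+suc⇒≤+ (subst (λ c → f v ℤ.< + c) (sym y-t) ft<xt)
            , ℤ.≤-trans (ℤ.+≤+ (≤-trans (n≤1+n _) (≤-reflexive y-t))) (proj₂ (proj₂ feasible v))
      ... | no v≢s | no v≢t = subst (λ c → (f v ℤ.≤ + c) × (+ c ℤ.≤ g v)) (sym (y-other v≢s v≢t)) (proj₂ feasible v)

      excess-change : ∀ j → ∑ (allFin n) (λ v → y v ∸ j) + ((x t ∸ j) + (x s ∸ j))
                          ≡ ∑ (allFin n) (λ v → x v ∸ j) + ((y t ∸ j) + (y s ∸ j))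
      excess-change j = begin
        ∑ (allFin n) (λ v → y v ∸ j) + ((x t ∸ j) + (x s ∸ j)) ≡⟨ cong (_+_ (∑ (allFin n) (λ v → y v ∸ j))) (two x) ⟨
        ∑ (allFin n) (λ v → y v ∸ j) + ∑ (allFin n) (ends x)   ≡⟨ ∑-cong-+ (allFin n) pointwise ⟩
        ∑ (allFin n) (λ v → x v ∸ j) + ∑ (allFin n) (ends y)   ≡⟨ cong (_+_ (∑ (allFin n) (λ v → x v ∸ j))) (two y) ⟩
        ∑ (allFin n) (λ v → x v ∸ j) + ((y t ∸ j) + (y s ∸ j)) ∎
        where
        open ≡-Reasoning
        ends : (Fin n → ℕ) → Fin n → ℕ
        ends z v = (if ⌊ v ≟ t ⌋ then z v ∸ j else 0) + (if ⌊ v ≟ s ⌋ then z v ∸ j else 0)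
        two : ∀ z → ∑ (allFin n) (ends z) ≡ (z t ∸ j) + (z s ∸ j)
        two z = trans (∑-+ (λ v → if ⌊ v ≟ t ⌋ then z v ∸ j else 0) _ (allFin n))
          (cong₂ _+_ (∑-indicator (λ v → z v ∸ j) t) (∑-indicator (λ v → z v ∸ j) s))
        pointwise : ∀ v → (y v ∸ j) + ends x v ≡ (x v ∸ j) + ends y v
        pointwise v with v ≟ t | v ≟ s
        ... | yes refl | yes refl = contradiction refl s≢t
        ... | yes refl | no _     = swap-ends (y v ∸ j) (x v ∸ j)
          where
          swap-ends : ∀ a b → a + (b + 0) ≡ b + (a + 0)
          swap-ends a b rewrite +-identityʳ a | +-identityʳ b = +-comm a b
        ... | no _     | yes refl = +-comm (y v ∸ j) (x v ∸ j)
        ... | no v≢t   | no v≢s   = cong (λ c → (c ∸ j) + 0) (y-other v≢s v≢t)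

      -- Convexity of truncated subtraction. If j ≤ y t, the term at `t` drops by exactly one and
      -- the term at `s` rises by at most one. Otherwise y s ≤ y t < j, and both new terms vanish.
      ends-≤ : ∀ j → (y t ∸ j) + (y s ∸ j) ≤ (x t ∸ j) + (x s ∸ j)
      ends-≤ j rewrite sym y-t | y-s with j ≤? y t
      ... | yes j≤b = begin
        (y t ∸ j) + (suc (x s) ∸ j)   ≤⟨ +-monoʳ-≤ (y t ∸ j) (m+n∸o≤ (x s)) ⟩
        (y t ∸ j) + suc (x s ∸ j)     ≡⟨ +-suc (y t ∸ j) (x s ∸ j) ⟩
        suc (y t ∸ j) + (x s ∸ j)     ≡⟨ cong (_+ (x s ∸ j)) (+-∸-assoc 1 j≤b) ⟨
        (suc (y t) ∸ j) + (x s ∸ j)   ∎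
        where
        open ≤-Reasoning
        m+n∸o≤ : ∀ a → suc a ∸ j ≤ suc (a ∸ j)
        m+n∸o≤ a = m≤n+o⇒m∸n≤o (suc a) j (≤-trans (s≤s (m≤n+m∸n a j)) (≤-reflexive (sym (+-suc j (a ∸ j)))))
      ... | no j≰b rewrite m≤n⇒m∸n≡0 (<⇒≤ (≰⇒> j≰b))
                         | m≤n⇒m∸n≡0 {suc (x s)} {j} (≤-trans (s≤s⁻¹ (subst (2 + x s ≤_) (sym y-t) 2+xs≤xt)) (<⇒≤ (≰⇒> j≰b))) = z≤n

      -- At this threshold `x t` exceeds by one, while `y t` and `y s` do not exceed at all.
      ends-< : (y t ∸ y t) + (y s ∸ y t) < (x t ∸ y t) + (x s ∸ y t)
      ends-< rewrite sym y-t | y-s | n∸n≡0 (y t)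
        | m≤n⇒m∸n≡0 {suc (x s)} {y t} (s≤s⁻¹ (subst (2 + x s ≤_) (sym y-t) 2+xs≤xt))
        | m+n∸n≡m 1 (y t) = s≤s z≤n

      weak : ∀ j → ∑ (allFin n) (λ v → y v ∸ j) ≤ ∑ (allFin n) (λ v → x v ∸ j)
      weak j = +-cancelʳ-≤ ((x t ∸ j) + (x s ∸ j)) _ _
        (≤-trans (≤-reflexive (excess-change j)) (+-monoʳ-≤ (∑ (allFin n) (λ v → x v ∸ j)) (ends-≤ j)))

      strict : ∑ (allFin n) (λ v → y v ∸ y t) < ∑ (allFin n) (λ v → x v ∸ y t)
      strict = +-cancelʳ-< ((x t ∸ y t) + (x s ∸ y t)) _ _
        (≤-<-trans (≤-reflexive (excess-change (y t))) (+-monoʳ-< (∑ (allFin n) (λ v → x v ∸ y t)) ends-<))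

      excess-≥ : ∀ j → ∑ (allFin n) (λ v → x v ∸ j) ≤ ∑ (allFin n) (λ v → y v ∸ j)
      excess-≥ j = subst₂ _≤_ (sortedInDegs-excess E D j) (sortedInDegs-excess E D′ j)
        (LexLeq⇒excess≤ (minimal D′ (connected′ , bounded′)) (sortedInDegs-descending E D)
          (λ i → subst₂ _≤_ (sym (sortedInDegs-excess E D′ i)) (sym (sortedInDegs-excess E D i)) (weak i)) j)

theorem10p8 : (n m : ℕ) (E : Edges n m) → Loopless E →
    (k : ℕ) → 1 ≤ k →
    (f g : Fin n → ℤ) → (∀ v → f v ℤ.≤ g v) →
    (D : Orientation m) → Feasible k f g E D →
    DecMin k f g E D ⇔
    (¬ (∃[ s ] ∃[ t ]
    ((+ indeg E D s ℤ.+ + 2 ℤ.≤ + indeg E D t)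
    × (f t ℤ.< + indeg E D t)
    × (+ indeg E D s ℤ.< g s)
    × ArcDisjointPaths (suc k) E D s t)))
theorem10p8 n m E loopless k _ f g _ D feasible = mk⇔
  (λ minimal → DecMin⇒¬improving E k f g feasible minimal)
  (λ ¬improving D′ feasible′ → ¬improving⇒LexLeq E k f g loopless feasible feasible′ ¬improving)
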